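{- Let $m\ge 3$ be an integer. There exist finite sets $A$ and $B$ of integers and an increasing sequence of positive integers $h_1<h_2<\cdots<h_m$ such that $|A|=|B|$, $\operatorname{diam}(A)=\operatorname{diam}(B)$, and for every $i\in\{1,\dots,m\}$, $$|h_i A|>|h_i B| \quad\text{if } i \text{ is odd},$$ and $$|h_i A|<|h_i B| \quad\text{if } i \text{ is even}.$$
   Context: For a nonempty set $A$ of integers and a positive integer $h$, the $h$-fold sumset of $A$ is $hA=\{a_1+\cdots+a_h : a_i\in A \text{ for all } 1\le i\le h\}$ (sums of $h$ not necessarily distinct elements of $A$). $|X|$ denotes the number of elements of a finite set $X$. For a finite nonempty set $A$ of integers, $\operatorname{diam}(A)=\max(A)-\min(A)$. -}

module Defs where

open import Data.Integer.Base using (ℤ; 0ℤ; _+_; _-_; _⊔_; _⊓_)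
open import Data.Integer.Properties using (_≟_)
open import Data.List.Base using (List; []; _∷_; map; cartesianProductWith; deduplicate; length)
open import Data.List.Membership.Propositional using (_∈_)
open import Data.List.Membership.Propositional.Properties
  using (∈-map⁺; ∈-map⁻; ∈-cartesianProductWith⁺; ∈-cartesianProductWith⁻)
open import Data.List.NonEmpty.Base using (List⁺; foldr₁; toList)
open import Data.List.Relation.Unary.Any using (here)
open import Data.Nat.Base using (ℕ; zero; suc)
open import Data.Product.Base using (∃; _×_; _,_)
open import Data.Vec.Base using (Vec; []; _∷_; foldr′)
open import Data.Vec.Relation.Unary.All using (All; []; _∷_)
open import Function.Bundles using (_⇔_; mk⇔)
open import Relation.Binary.PropositionalEquality using (_≡_; refl)

-- A list of integers stands for the finite set of its entries; order and
-- repetitions carry no information.  A finite nonempty set is a List⁺ ℤ.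

∣_∣ : List ℤ → ℕ
∣ xs ∣ = length (deduplicate _≟_ xs)

diam : List⁺ ℤ → ℤ
diam A = foldr₁ _⊔_ A - foldr₁ _⊓_ A

tuples : (h : ℕ) → List ℤ → List (Vec ℤ h)
tuples zero    xs = [] ∷ []
tuples (suc h) xs = cartesianProductWith _∷_ xs (tuples h xs)

sumᵛ : ∀ {h} → Vec ℤ h → ℤ
sumᵛ = foldr′ _+_ 0ℤ

infixr 8 _⋆_

_⋆_ : ℕ → List⁺ ℤ → List ℤ
h ⋆ A = map sumᵛ (tuples h (toList A))

∈-tuples⁺ : ∀ {h xs} {v : Vec ℤ h} → All (_∈ xs) v → v ∈ tuples h xs
∈-tuples⁺ []         = here refl
∈-tuples⁺ (px ∷ pxs) = ∈-cartesianProductWith⁺ _∷_ px (∈-tuples⁺ pxs)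

∈-tuples⁻ : ∀ h {xs} {v : Vec ℤ h} → v ∈ tuples h xs → All (_∈ xs) v
∈-tuples⁻ zero    {v = []} _ = []
∈-tuples⁻ (suc h) {xs} v∈
  with _ , _ , x∈ , w∈ , refl ← ∈-cartesianProductWith⁻ _∷_ xs (tuples h xs) v∈
  = x∈ ∷ ∈-tuples⁻ h w∈

-- hA = { a₁ + ⋯ + aₕ : aᵢ ∈ A }
∈-⋆ : ∀ h A {x} →
      x ∈ h ⋆ A ⇔ ∃ λ (a : Vec ℤ h) → All (_∈ toList A) a × x ≡ sumᵛ a
∈-⋆ h A {x} = mk⇔ to from
  where
  to : x ∈ h ⋆ A → ∃ λ (a : Vec ℤ h) → All (_∈ toList A) a × x ≡ sumᵛ a
  to x∈ with a , a∈ , eq ← ∈-map⁻ sumᵛ x∈ = a , ∈-tuples⁻ h a∈ , eq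

  from : (∃ λ (a : Vec ℤ h) → All (_∈ toList A) a × x ≡ sumᵛ a) → x ∈ h ⋆ A
  from (a , a⊆A , refl) = ∈-map⁺ sumᵛ (∈-tuples⁺ a⊆A)

{-# OPTIONS --safe #-}

-- The sets are built by induction on the number m of lead changes.  Given A and B with diameter d
-- and last height H, put p = H + 1, e = 2 (2 d + 1), N = e p, and replace A and B by A + M C and
-- B + M D (or A + M D and B + M C), where C = {0, 1, N}, D = {0, e, N} and M > 2 N d.  For h ≤ 2 N
-- the sums do not carry, so |h (A + M C)| = |hA| |hC|.  For h ≤ H all sums in hC and in hD are
-- distinct, so |hC| = |hD| and the earlier races are undisturbed.  But D = e {0, 1, p} gives
-- |hD| ≤ h p + 1, while |hC| ≥ N (N + 2) at h = 2 N; as h + 1 ≤ |hA|, |hB| ≤ h d + 1, the set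
-- receiving C wins at h = 2 N.

module Submission where

open import Defs
open import Data.Fin.Base using (Fin; toℕ) renaming (_<_ to _<ᶠ_)
open import Data.Integer.Base using (ℤ)
open import Data.List.NonEmpty.Base using (List⁺; toList)
open import Data.Nat.Base using (ℕ; suc; _≤_; _<_; _>_)
open import Data.Nat.Divisibility using (_∣_)
open import Data.Product.Base using (∃; _×_)
open import Relation.Binary.PropositionalEquality using (_≡_)
open import Relation.Nullary.Negation using (¬_)

open import Data.Fin.Base using (zero; suc)
open import Data.Fin.Properties using (injective⇒≤; toℕ<n)
import Data.Integer.Base as ℤ
import Data.Integer.Properties as ℤ
open import Data.List.Base
  using (List; []; _∷_; map; length; lookup; deduplicate; cartesianProduct; cartesianProductWith; upTo)
open import Data.List.Membership.Propositional using (_∈_)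
open import Data.List.Membership.Propositional.Properties
  using (∈-map⁺; ∈-map⁻; ∈-lookup; ∈-deduplicate⁺; ∈-deduplicate⁻; ∈-upTo⁺; ∈-upTo⁻;
         ∈-cartesianProductWith⁺; ∈-cartesianProductWith⁻; ∈-cartesianProduct⁺; ∈-cartesianProduct⁻)
open import Data.List.NonEmpty.Base using (_∷_; foldr₁)
open import Data.List.Properties using (length-upTo; length-++; length-map)
open import Data.List.Relation.Unary.All as All using (_∷_)
open import Data.List.Relation.Unary.Any using (here; there; index)
open import Data.List.Relation.Unary.Any.Properties using (lookup-index)
open import Data.List.Relation.Unary.Unique.Propositional using (Unique; _∷_)
open import Data.List.Relation.Unary.Unique.Propositional.Properties
  using (upTo⁺; cartesianProduct⁺)
open import Data.List.Relation.Unary.Unique.DecPropositional.Properties using (deduplicate-!)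
open import Data.Nat.Base using (zero; _+_; _*_; z≤n; s≤s; s≤s⁻¹; NonZero; parity; >-nonZero; >-nonZero⁻¹)
open import Data.Nat.Divisibility using (∣m+n∣m⇒∣n; ∣1⇒≡1; ∣m∣n⇒∣m+n; ∣-refl)
open import Data.Nat.DivMod using (_%_; [m+kn]%n≡m%n; m<n⇒m%n≡m)
open import Data.Nat.Properties
open import Data.Nat.Tactic.RingSolver using (solve-∀)
open import Data.Parity.Base as ℙ using (Parity; 0ℙ; 1ℙ)
open import Data.Parity.Properties using (p+p≡0ℙ; p⁻¹+p≡1ℙ)
open import Data.Product.Base using (∃₂; _,_; proj₁; proj₂)
open import Data.Sum.Base using (_⊎_; inj₁; inj₂)
open import Data.Vec.Base using (Vec) renaming ([] to []ᵛ; _∷_ to _∷ᵛ_)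
open import Data.Vec.Relation.Unary.All using () renaming (All to Allᵛ; [] to []ᵃ; _∷_ to _∷ᵃ_)
open import Function.Base using (_∘_)
open import Function.Bundles using (Equivalence)
open import Relation.Binary.PropositionalEquality
  using (refl; sym; trans; cong; cong₂; subst; subst₂; module ≡-Reasoning)
open import Relation.Nullary.Negation using (contradiction)

-- Counting by injections

lookup-injective : ∀ {X : Set} {xs : List X} → Unique xs → ∀ i j → lookup xs i ≡ lookup xs j → i ≡ j
lookup-injective (_   ∷ _)   zero    zero    _  = refl
lookup-injective (x∉  ∷ _)   zero    (suc j) eq = contradiction eq (All.lookup x∉ (∈-lookup j))
lookup-injective (x∉  ∷ _)   (suc i) zero    eq = contradiction (sym eq) (All.lookup x∉ (∈-lookup i))
lookup-injective (_   ∷ xs!) (suc i) (suc j) eq = cong suc (lookup-injective xs! i j eq)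

-- Choosing a partner for each entry gives an injection of positions, because no `y` serves two
-- different entries. A relation replaces a function so that partners may come out of existential
-- statements.
length-≤ : ∀ {X Y : Set} (R : X → Y → Set) {xs ys} → Unique xs →
           (∀ {x} → x ∈ xs → ∃ λ y → y ∈ ys × R x y) →
           (∀ {x x′ y} → R x y → R x′ y → x ≡ x′) →
           length xs ≤ length ys
length-≤ R {xs} {ys} xs! total unique = injective⇒≤ {f = image} injective
  where
  image : Fin (length xs) → Fin (length ys)
  image i = index (proj₁ (proj₂ (total (∈-lookup i))))

  R-image : ∀ i → R (lookup xs i) (lookup ys (image i))
  R-image i with _ , y∈ , r ← total (∈-lookup {xs = xs} i) = subst (R _) (lookup-index y∈) r

  injective : ∀ {i j} → image i ≡ image j → i ≡ j
  injective {i} {j} eq =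
    lookup-injective xs! i j (unique (R-image i) (subst (R _ ∘ lookup ys) (sym eq) (R-image j)))

size : List ℕ → ℕ
size xs = length (deduplicate _≟_ xs)

size≤length : ∀ {X : Set} (R : ℕ → X → Set) {xs ys} →
              (∀ {x} → x ∈ xs → ∃ λ y → y ∈ ys × R x y) →
              (∀ {x x′ y} → R x y → R x′ y → x ≡ x′) →
              size xs ≤ length ys
size≤length R {xs} total = length-≤ R (deduplicate-! _≟_ xs) (total ∘ ∈-deduplicate⁻ _≟_ xs)

length≤size : ∀ {X : Set} (R : X → ℕ → Set) {xs ys} → Unique xs →
              (∀ {x} → x ∈ xs → ∃ λ y → y ∈ ys × R x y) →
              (∀ {x x′ y} → R x y → R x′ y → x ≡ x′) →
              length xs ≤ size ys
length≤size R xs! total =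
  length-≤ R xs! (λ x∈ → let y , y∈ , r = total x∈ in y , ∈-deduplicate⁺ _≟_ y∈ , r)

size≤size : ∀ (R : ℕ → ℕ → Set) {xs ys} →
            (∀ {x} → x ∈ xs → ∃ λ y → y ∈ ys × R x y) →
            (∀ {x x′ y} → R x y → R x′ y → x ≡ x′) →
            size xs ≤ size ys
size≤size R {xs} total =
  length≤size R (deduplicate-! _≟_ xs) (total ∘ ∈-deduplicate⁻ _≟_ xs)

length-cartesianProduct : ∀ {X Y : Set} (xs : List X) (ys : List Y) →
                          length (cartesianProduct xs ys) ≡ length xs * length ys
length-cartesianProduct []       ys = refl
length-cartesianProduct (x ∷ xs) ys = trans (length-++ (map (x ,_) ys))
  (cong₂ _+_ (length-map (x ,_) ys) (length-cartesianProduct xs ys))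

-- Reduction modulo `M` reads off the low digit, and cancellation then gives the high one, which may
-- be arbitrarily large. Every count of distinct sums below rests on this.
digits-unique : ∀ M .{{_ : NonZero M}} {i i′} j j′ → i < M → i′ < M →
                i + M * j ≡ i′ + M * j′ → i ≡ i′ × j ≡ j′
digits-unique M {i} {i′} j j′ i<M i′<M eq = i≡i′ , j≡j′
  where
  low : ∀ {k} l → k < M → (k + M * l) % M ≡ k
  low {k} l k<M = trans (cong (λ z → (k + z) % M) (*-comm M l))
    (trans ([m+kn]%n≡m%n k l M) (m<n⇒m%n≡m k<M))

  i≡i′ : i ≡ i′
  i≡i′ = trans (sym (low j i<M)) (trans (cong (_% M) eq) (low j′ i′<M))

  j≡j′ : j ≡ j′
  j≡j′ = *-cancelˡ-≡ j j′ M (+-cancelˡ-≡ i _ _ (trans eq (cong (_+ M * j′) (sym i≡i′))))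

-- Iterated sumsets of lists of natural numbers

sums : ℕ → List ℕ → List ℕ
sums zero    xs = 0 ∷ []
sums (suc h) xs = cartesianProductWith _+_ xs (sums h xs)

+∈sums : ∀ {h xs a k} → a ∈ xs → k ∈ sums h xs → a + k ∈ sums (suc h) xs
+∈sums a∈ k∈ = ∈-cartesianProductWith⁺ _+_ a∈ k∈

0∈sums : ∀ h {xs} → 0 ∈ xs → 0 ∈ sums h xs
0∈sums zero    0∈ = here refl
0∈sums (suc h) 0∈ = ∈-cartesianProductWith⁺ _+_ 0∈ (0∈sums h 0∈)

sums-bounded : ∀ h {d xs k} → (∀ {a} → a ∈ xs → a ≤ d) → k ∈ sums h xs → k ≤ h * d
sums-bounded zero    xs≤d (here refl) = z≤n
sums-bounded (suc h) {xs = xs} xs≤d k∈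
  with a , s , a∈ , s∈ , refl ← ∈-cartesianProductWith⁻ _+_ xs (sums h xs) k∈
  = +-mono-≤ (xs≤d a∈) (sums-bounded h xs≤d s∈)

-- All sums lie in the interval from 0 to `h * d`.
size-sums-≤ : ∀ h {d xs} → (∀ {a} → a ∈ xs → a ≤ d) → size (sums h xs) ≤ suc (h * d)
size-sums-≤ h {d} {xs} xs≤d = subst (size (sums h xs) ≤_) (length-upTo (suc (h * d)))
  (size≤length _≡_ (λ x∈ → _ , ∈-upTo⁺ (s≤s (sums-bounded h xs≤d x∈)) , refl)
    (λ { refl refl → refl }))

*∈sums : ∀ {h d xs} → 0 ∈ xs → d ∈ xs → ∀ {j} → j ≤ h → j * d ∈ sums h xs
*∈sums {h} 0∈ d∈ z≤n       = 0∈sums h 0∈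
*∈sums     0∈ d∈ (s≤s j≤h) = ∈-cartesianProductWith⁺ _+_ d∈ (*∈sums 0∈ d∈ j≤h)

-- The multiples 0, d, ..., h d are already h + 1 distinct sums.
size-sums-> : ∀ h d .{{_ : NonZero d}} {xs} → 0 ∈ xs → d ∈ xs → h < size (sums h xs)
size-sums-> h d {xs} 0∈ d∈ = subst (_≤ size (sums h xs)) (length-upTo (suc h))
  (length≤size (λ j s → s ≡ j * d) (upTo⁺ (suc h))
    (λ j∈ → _ , *∈sums 0∈ d∈ (s≤s⁻¹ (∈-upTo⁻ j∈)) , refl)
    (λ {j} {j′} p q → *-cancelʳ-≡ j j′ d (trans (sym p) q)))

-- This makes the cardinality of a set the case h = 1 of the sumset computations.
size-1-sums : ∀ xs → size (sums 1 xs) ≡ size xs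
size-1-sums xs = ≤-antisym
  (size≤size _≡_ (λ x∈ → _ , ⊆₁ x∈ , refl) (λ { refl refl → refl }))
  (size≤size _≡_ (λ x∈ → _ , ⊆₂ x∈ , refl) (λ { refl refl → refl }))
  where
  ⊆₁ : ∀ {x} → x ∈ sums 1 xs → x ∈ xs
  ⊆₁ x∈ with a , _ , a∈ , here refl , refl ← ∈-cartesianProductWith⁻ _+_ xs (0 ∷ []) x∈
    = subst (_∈ xs) (sym (+-identityʳ a)) a∈

  ⊆₂ : ∀ {x} → x ∈ xs → x ∈ sums 1 xs
  ⊆₂ {x} x∈ = subst (_∈ sums 1 xs) (+-identityʳ x) (∈-cartesianProductWith⁺ _+_ x∈ (here refl))

-- Sums of a set and a dilate

_⊕[_]_ : List ℕ → ℕ → List ℕ → List ℕ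
xs ⊕[ M ] ys = cartesianProductWith (λ x y → x + M * y) xs ys

0∈⊕ : ∀ {xs} M {ys} → 0 ∈ xs → 0 ∈ ys → 0 ∈ xs ⊕[ M ] ys
0∈⊕ {xs} M {ys} 0∈xs 0∈ys =
  subst (_∈ xs ⊕[ M ] ys) (*-zeroʳ M) (∈-cartesianProductWith⁺ (λ x y → x + M * y) 0∈xs 0∈ys)

⊕-interchange : ∀ x y u v M → (x + M * y) + (u + M * v) ≡ (x + u) + M * (y + v)
⊕-interchange = solve-∀

-- Adding the two components separately splits an h-fold sum; with the converse below, h(X + M Y) =
-- hX + M hY.
∈-sums-⊕⁻ : ∀ h xs M ys {k} → k ∈ sums h (xs ⊕[ M ] ys) →
            ∃₂ λ u v → u ∈ sums h xs × v ∈ sums h ys × k ≡ u + M * v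
∈-sums-⊕⁻ zero    xs M ys (here refl) = 0 , 0 , here refl , here refl , sym (*-zeroʳ M)
∈-sums-⊕⁻ (suc h) xs M ys k∈
  with a , s , a∈ , s∈ , refl ← ∈-cartesianProductWith⁻ _+_ (xs ⊕[ M ] ys) (sums h (xs ⊕[ M ] ys)) k∈
  with x , y , x∈ , y∈ , refl ← ∈-cartesianProductWith⁻ (λ x y → x + M * y) xs ys a∈
  with u , v , u∈ , v∈ , refl ← ∈-sums-⊕⁻ h xs M ys s∈
  = x + u , y + v , ∈-cartesianProductWith⁺ _+_ x∈ u∈ , ∈-cartesianProductWith⁺ _+_ y∈ v∈
  , ⊕-interchange x y u v M

∈-sums-⊕⁺ : ∀ h xs M ys {u v} → u ∈ sums h xs → v ∈ sums h ys → u + M * v ∈ sums h (xs ⊕[ M ] ys)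
∈-sums-⊕⁺ zero    xs M ys (here refl) (here refl) = here (*-zeroʳ M)
∈-sums-⊕⁺ (suc h) xs M ys u∈ v∈
  with x , u , x∈ , u∈ , refl ← ∈-cartesianProductWith⁻ _+_ xs (sums h xs) u∈
  with y , v , y∈ , v∈ , refl ← ∈-cartesianProductWith⁻ _+_ ys (sums h ys) v∈
  = subst (_∈ sums (suc h) (xs ⊕[ M ] ys)) (⊕-interchange x y u v M)
      (∈-cartesianProductWith⁺ _+_ (∈-cartesianProductWith⁺ _ x∈ y∈) (∈-sums-⊕⁺ h xs M ys u∈ v∈))

-- There are no carries: the part from hX is at most h d < M, so a sum u + M v determines the pair
-- (u, v).
size-sums-⊕ : ∀ h {d xs} M ys → (∀ {a} → a ∈ xs → a ≤ d) → h * d < M →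
              size (sums h (xs ⊕[ M ] ys)) ≡ size (sums h xs) * size (sums h ys)
size-sums-⊕ h {d} {xs} M ys xs≤d hd<M = ≤-antisym
  (subst (size (sums h (xs ⊕[ M ] ys)) ≤_) length-pairs
    (size≤length (λ { k (u , v) → k ≡ u + M * v })
      (λ k∈ → let u , v , u∈ , v∈ , eq = ∈-sums-⊕⁻ h xs M ys k∈
              in (u , v) , ∈-cartesianProduct⁺ (∈-deduplicate⁺ _≟_ u∈) (∈-deduplicate⁺ _≟_ v∈) , eq)
      (λ p q → trans p (sym q))))
  (subst (_≤ size (sums h (xs ⊕[ M ] ys))) length-pairs
    -- The bound u < M is part of the relation because the uniqueness argument sees only related
    -- pairs, not their membership in the lists.
    (length≤size (λ { (u , v) k → u < M × k ≡ u + M * v })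
      (cartesianProduct⁺ (deduplicate-! _≟_ (sums h xs)) (deduplicate-! _≟_ (sums h ys)))
      (λ p∈ → let u∈′ , v∈′ = ∈-cartesianProduct⁻ (deduplicate _≟_ (sums h xs)) _ p∈
                  u∈ = ∈-deduplicate⁻ _≟_ (sums h xs) u∈′
                  v∈ = ∈-deduplicate⁻ _≟_ (sums h ys) v∈′
              in _ , ∈-sums-⊕⁺ h xs M ys u∈ v∈ , ≤-<-trans (sums-bounded h xs≤d u∈) hd<M , refl)
      (λ { {u , v} {u′ , v′} (u< , p) (u′< , q) →
           let u≡u′ , v≡v′ = digits-unique M {{>-nonZero (≤-<-trans z≤n hd<M)}} v v′ u< u′< (trans (sym p) q)
           in cong₂ _,_ u≡u′ v≡v′ })))
  where
  length-pairs : length (cartesianProduct (deduplicate _≟_ (sums h xs)) (deduplicate _≟_ (sums h ys)))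
               ≡ size (sums h xs) * size (sums h ys)
  length-pairs = length-cartesianProduct (deduplicate _≟_ (sums h xs)) (deduplicate _≟_ (sums h ys))

-- Sets {0, a, b}

add-first : ∀ a b i j → a + (a * i + b * j) ≡ a * suc i + b * j
add-first = solve-∀

add-second : ∀ a b i j → b + (a * i + b * j) ≡ a * i + b * suc j
add-second = solve-∀

-- Here i and j count the summands equal to a and b. The remaining summands are 0, hence an
-- inequality instead of i + j = h.
∈-sums-triple⁻ : ∀ h a b {k} → k ∈ sums h (0 ∷ a ∷ b ∷ []) →
                 ∃₂ λ i j → i + j ≤ h × k ≡ a * i + b * j
∈-sums-triple⁻ zero    a b (here refl) = 0 , 0 , z≤n , sym (cong₂ _+_ (*-zeroʳ a) (*-zeroʳ b))
∈-sums-triple⁻ (suc h) a b k∈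
  with x , s , x∈ , s∈ , refl ← ∈-cartesianProductWith⁻ _+_ (0 ∷ a ∷ b ∷ []) (sums h (0 ∷ a ∷ b ∷ [])) k∈
  with i , j , i+j≤h , refl ← ∈-sums-triple⁻ h a b s∈
  with x∈
... | here refl                 = i , j , m≤n⇒m≤1+n i+j≤h , refl
... | there (here refl)         = suc i , j , s≤s i+j≤h , add-first a b i j
... | there (there (here refl)) =
  i , suc j , subst (_≤ suc h) (sym (+-suc i j)) (s≤s i+j≤h) , add-second a b i j

∈-sums-triple⁺ : ∀ h a b {i j} → i + j ≤ h → a * i + b * j ∈ sums h (0 ∷ a ∷ b ∷ [])
∈-sums-triple⁺ h a b {zero} {zero} _ =
  subst (_∈ sums h (0 ∷ a ∷ b ∷ [])) (sym (cong₂ _+_ (*-zeroʳ a) (*-zeroʳ b))) (0∈sums h (here refl))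
∈-sums-triple⁺ (suc h) a b {zero} {suc j} (s≤s j≤h) =
  subst (_∈ sums (suc h) (0 ∷ a ∷ b ∷ [])) (add-second a b 0 j)
    (+∈sums {h} {0 ∷ a ∷ b ∷ []} (there (there (here refl))) (∈-sums-triple⁺ h a b j≤h))
∈-sums-triple⁺ (suc h) a b {suc i} {j} (s≤s i+j≤h) =
  subst (_∈ sums (suc h) (0 ∷ a ∷ b ∷ [])) (add-first a b i j)
    (+∈sums {h} {0 ∷ a ∷ b ∷ []} (there (here refl)) (∈-sums-triple⁺ h a b i+j≤h))

-- With N = e p, parity `0ℙ` gives the set C with many sums and `1ℙ` the set D with few. Indexing by
-- `Parity` lets the recipient of each be computed by adding parities.
triple : ℕ → ℕ → Parity → List ℕ
triple e p 0ℙ = 0 ∷ 1 ∷ e * p ∷ []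
triple e p 1ℙ = 0 ∷ e ∷ e * p ∷ []

0∈triple : ∀ e p q → 0 ∈ triple e p q
0∈triple e p 0ℙ = here refl
0∈triple e p 1ℙ = here refl

max∈triple : ∀ e p q → e * p ∈ triple e p q
max∈triple e p 0ℙ = there (there (here refl))
max∈triple e p 1ℙ = there (there (here refl))

module _ (e p : ℕ) .{{_ : NonZero e}} .{{_ : NonZero p}} where

  private
    instance
      e*p≢0 : NonZero (e * p)
      e*p≢0 = m*n≢0 e p

  factor-e : ∀ i j → e * i + e * p * j ≡ e * (i + p * j)
  factor-e i j = trans (cong (e * i +_) (*-assoc e p j)) (sym (*-distribˡ-+ e i (p * j)))

  triple-bounded : ∀ q {a} → a ∈ triple e p q → a ≤ e * p
  triple-bounded 0ℙ (here refl)                 = z≤n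
  triple-bounded 0ℙ (there (here refl))         = >-nonZero⁻¹ (e * p)
  triple-bounded 0ℙ (there (there (here refl))) = ≤-refl
  triple-bounded 1ℙ (here refl)                 = z≤n
  triple-bounded 1ℙ (there (here refl))         = m≤m*n e p
  triple-bounded 1ℙ (there (there (here refl))) = ≤-refl

  -- A sum in either set determines its coefficients (i, j): they are base e p digits in C and,
  -- after division by e, base p digits in D, since i ≤ h < p. Both sumsets are therefore counted by
  -- the pairs with i + j ≤ h.
  size-triple-≡ : ∀ {h} → h < p → ∀ q q′ →
                  size (sums h (triple e p q)) ≡ size (sums h (triple e p q′))
  size-triple-≡ {h} h<p = λ where
      0ℙ 0ℙ → refl
      0ℙ 1ℙ → sizes≡
      1ℙ 0ℙ → sym sizes≡
      1ℙ 1ℙ → refl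
    where
    -- Two sums correspond when they share a coefficient pair. The factor `1 *` matches the form of
    -- `∈-sums-triple⁻` at a = 1.
    Corresponding : ℕ → ℕ → Set
    Corresponding x y = ∃₂ λ i j → i + j ≤ h × x ≡ 1 * i + e * p * j × y ≡ e * i + e * p * j

    i<p : ∀ {i j} → i + j ≤ h → i < p
    i<p i+j≤h = ≤-<-trans (m+n≤o⇒m≤o _ i+j≤h) h<p

    i<ep : ∀ {i j} → i + j ≤ h → 1 * i < e * p
    i<ep {i} i+j≤h = ≤-<-trans (≤-reflexive (*-identityˡ i)) (<-≤-trans (i<p i+j≤h) (m≤n*m p e))

    left-unique : ∀ {x x′ y} → Corresponding x y → Corresponding x′ y → x ≡ x′
    left-unique (i , j , ≤h , refl , y≡) (i′ , j′ , ≤h′ , refl , y≡′)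
      with i≡ , j≡ ← digits-unique p j j′ (i<p ≤h) (i<p ≤h′)
             (*-cancelˡ-≡ _ _ e (trans (sym (factor-e i j)) (trans (trans (sym y≡) y≡′) (factor-e i′ j′))))
      = cong₂ (λ i j → 1 * i + e * p * j) i≡ j≡

    right-unique : ∀ {y y′ x} → Corresponding x y → Corresponding x y′ → y ≡ y′
    right-unique (i , j , ≤h , x≡ , refl) (i′ , j′ , ≤h′ , x≡′ , refl)
      with i≡ , j≡ ← digits-unique (e * p) j j′ (i<ep ≤h) (i<ep ≤h′) (trans (sym x≡) x≡′)
      = cong₂ (λ i j → e * i + e * p * j) (*-cancelˡ-≡ i i′ 1 i≡) j≡

    sizes≡ : size (sums h (triple e p 0ℙ)) ≡ size (sums h (triple e p 1ℙ))
    sizes≡ = ≤-antisym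
      (size≤size Corresponding
        (λ x∈ → let i , j , ≤h , x≡ = ∈-sums-triple⁻ h 1 (e * p) x∈
                in _ , ∈-sums-triple⁺ h e (e * p) ≤h , i , j , ≤h , x≡ , refl)
        left-unique)
      (size≤size (λ y x → Corresponding x y)
        (λ y∈ → let i , j , ≤h , y≡ = ∈-sums-triple⁻ h e (e * p) y∈
                in _ , ∈-sums-triple⁺ h 1 (e * p) ≤h , i , j , ≤h , refl , y≡)
        right-unique)

  -- The second triple is the e-fold dilate of {0, 1, p}, so its sumsets eventually grow e times slower.
  size-triple-≤ : ∀ h → size (sums h (triple e p 1ℙ)) ≤ suc (h * p)
  size-triple-≤ h = subst (size (sums h (triple e p 1ℙ)) ≤_) (length-upTo (suc (h * p)))
    (size≤length (λ k y → k ≡ e * y)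
      (λ k∈ → let i , j , i+j≤h , k≡ = ∈-sums-triple⁻ h e (e * p) k∈
              in i + p * j , ∈-upTo⁺ (s≤s (bound i j i+j≤h)) , trans k≡ (factor-e i j))
      (λ r r′ → trans r (sym r′)))
    where
    bound : ∀ i j → i + j ≤ h → i + p * j ≤ h * p
    bound i j i+j≤h = begin
      i + p * j      ≤⟨ +-monoˡ-≤ (p * j) (m≤n*m i p) ⟩
      p * i + p * j  ≡⟨ *-distribˡ-+ p i j ⟨
      p * (i + j)    ≤⟨ *-monoʳ-≤ p i+j≤h ⟩
      p * h          ≡⟨ *-comm p h ⟩
      h * p          ∎
      where open ≤-Reasoning

  -- The rectangle i < N, j < N + 2 fits under i + j ≤ 2N, its corner being (N - 1) + (N + 1), and
  -- the sums i + N j over it are distinct in base N.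
  size-triple-≥ : let N = e * p in N * (2 + N) ≤ size (sums (2 * N) (triple e p 0ℙ))
  size-triple-≥ = subst (_≤ size (sums (2 * N) (triple e p 0ℙ)))
      (trans (length-cartesianProduct (upTo N) (upTo (2 + N))) (cong₂ _*_ (length-upTo N) (length-upTo (2 + N))))
      (length≤size (λ { (i , j) k → i < N × k ≡ 1 * i + N * j })
        (cartesianProduct⁺ (upTo⁺ N) (upTo⁺ (2 + N)))
        (λ { {i , j} ij∈ →
             let i∈ , j∈ = ∈-cartesianProduct⁻ (upTo N) (upTo (2 + N)) ij∈
             in _ , ∈-sums-triple⁺ (2 * N) 1 N (bound (∈-upTo⁻ i∈) (∈-upTo⁻ j∈)) , ∈-upTo⁻ i∈ , refl })
        (λ { {i , j} {i′ , j′} (i< , p) (i′< , q) →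
             let i≡ , j≡ = digits-unique N j j′ i< i′<
                   (trans (cong (_+ N * j) (sym (*-identityˡ i)))
                     (trans (trans (sym p) q) (cong (_+ N * j′) (*-identityˡ i′))))
             in cong₂ _,_ i≡ j≡ }))
    where
    N = e * p

    bound : ∀ {i j} → i < N → j < 2 + N → i + j ≤ 2 * N
    bound {i} {j} i<N j<2+N = s≤s⁻¹ (begin
      suc i + j     ≤⟨ +-mono-≤ i<N (s≤s⁻¹ j<2+N) ⟩
      N + (1 + N)   ≡⟨ rearrange N ⟩
      suc (2 * N)   ∎)
      where
      open ≤-Reasoning
      rearrange : ∀ N → N + (1 + N) ≡ suc (2 * N)
      rearrange = solve-∀

-- The two families

-- After n stages, `height n` is the last height to be protected and `width n` is the common maximum
-- of the two sets. The initial height 1 is not a race; it protects the equality of cardinalities.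
height width ratio period span modulus : ℕ → ℕ

height zero    = 1
height (suc n) = 2 * span n

width zero    = 1
width (suc n) = width n + modulus n * span n

-- In the notation of the construction these are e, p, N and M. `period n` just exceeds every
-- earlier height, and `modulus n` just exceeds the largest low part occurring up to height 2N.
ratio n   = 2 * suc (2 * width n)
period n  = suc (height n)
span n    = ratio n * period n
modulus n = suc (2 * span n * width n)

-- Both families start from {0, 1}. At stage n the parities add to `0ℙ` exactly when q is the parity
-- of n, so the two racers receive C alternately and the other one receives D.
racer : Parity → ℕ → List ℕ
racer q zero    = 0 ∷ 1 ∷ []
racer q (suc n) = racer q n ⊕[ modulus n ] triple (ratio n) (period n) (q ℙ.+ parity n)

0∈racer : ∀ q n → 0 ∈ racer q n
0∈racer q zero    = here refl
0∈racer q (suc n) = 0∈⊕ (modulus n) (0∈racer q n) (0∈triple _ _ (q ℙ.+ parity n))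

-- C and D have the same maximum N, so the maximum attained does not depend on q; this gives equal
-- diameters.
width∈racer : ∀ q n → width n ∈ racer q n
width∈racer q zero    = there (here refl)
width∈racer q (suc n) =
  ∈-cartesianProductWith⁺ _ (width∈racer q n) (max∈triple (ratio n) (period n) (q ℙ.+ parity n))

racer-bounded : ∀ q n {a} → a ∈ racer q n → a ≤ width n
racer-bounded q zero    (here refl)         = z≤n
racer-bounded q zero    (there (here refl)) = ≤-refl
racer-bounded q (suc n) a∈
  with x , y , x∈ , y∈ , refl ← ∈-cartesianProductWith⁻ _ (racer q n) _ a∈
  = +-mono-≤ (racer-bounded q n x∈)
      (*-monoʳ-≤ (modulus n) (triple-bounded (ratio n) (period n) (q ℙ.+ parity n) y∈))

0<width : ∀ n → 0 < width n
0<width zero    = s≤s z≤n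
0<width (suc n) = m≤n⇒m≤n+o (modulus n * span n) (0<width n)

height<height : ∀ n → height n < height (suc n)
height<height n = ≤-trans (m≤n*m (period n) (ratio n)) (m≤n*m (span n) 2)

height-mono-≤ : ∀ {i n} → i ≤ n → height i ≤ height n
height-mono-≤ {n = zero}  z≤n = ≤-refl
height-mono-≤ {i} {suc n} i≤1+n with m≤n⇒m<n∨m≡n i≤1+n
... | inj₁ i<1+n = ≤-trans (height-mono-≤ (s≤s⁻¹ i<1+n)) (<⇒≤ (height<height n))
... | inj₂ refl  = ≤-refl

height-mono-< : ∀ {i n} → i < n → height i < height n
height-mono-< {i} i<n = <-≤-trans (height<height i) (height-mono-≤ i<n)

-- The choice of `modulus n` excludes carries at every height up to that of the race added at this
-- stage.
size-racer : ∀ q n h → h ≤ height (suc n) →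
             size (sums h (racer q (suc n))) ≡
             size (sums h (racer q n)) * size (sums h (triple (ratio n) (period n) (q ℙ.+ parity n)))
size-racer q n h h≤ =
  size-sums-⊕ h (modulus n) _ (racer-bounded q n) (s≤s (*-monoˡ-≤ (width n) h≤))

-- Since 1 is below every `period n`, each stage multiplies both cardinalities by the same factor.
size-racers-≡ : ∀ n q q′ → size (sums 1 (racer q n)) ≡ size (sums 1 (racer q′ n))
size-racers-≡ zero    q q′ = refl
size-racers-≡ (suc n) q q′ = begin
  size (sums 1 (racer q (suc n)))                    ≡⟨ size-racer q n 1 (height-mono-≤ {n = suc n} z≤n) ⟩
  size (sums 1 (racer q n)) * size (sums 1 (T q))    ≡⟨ cong₂ _*_ (size-racers-≡ n q q′) T≡ ⟩
  size (sums 1 (racer q′ n)) * size (sums 1 (T q′))  ≡⟨ size-racer q′ n 1 (height-mono-≤ {n = suc n} z≤n) ⟨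
  size (sums 1 (racer q′ (suc n)))                   ∎
  where
  open ≡-Reasoning

  T : Parity → List ℕ
  T q = triple (ratio n) (period n) (q ℙ.+ parity n)

  T≡ : size (sums 1 (T q)) ≡ size (sums 1 (T q′))
  T≡ = size-triple-≡ (ratio n) (period n) (s≤s (height-mono-≤ {n = n} z≤n))
         (q ℙ.+ parity n) (q′ ℙ.+ parity n)

-- Deciding the new race and preserving the old ones

crude-bound : ∀ d p .{{_ : NonZero p}} → let N = 2 * suc (2 * d) * p in
              suc (2 * N * d) * suc (2 * N * p) < suc (2 * N) * (N * (2 + N))
crude-bound d p = begin-strict
  suc (2 * N * d) * suc (2 * N * p)              ≤⟨ *-mono-≤ (+-monoˡ-≤ (2 * N * d) 0<N)
                                                      (+-monoˡ-≤ (2 * N * p) 0<2Np) ⟩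
  -- The product is 4 (2d + 1) p N^2, and e = 2 (2d + 1) is chosen so that 4 (2d + 1) p is 2N.
  (N + 2 * N * d) * (N * p + N * p + 2 * N * p)  ≡⟨ collect N d p ⟩
  2 * N * (N * N)                                ≤⟨ *-mono-≤ (n≤1+n (2 * N)) (*-monoʳ-≤ N (n≤1+n N)) ⟩
  suc (2 * N) * (N * (1 + N))                    <⟨ *-monoʳ-< (suc (2 * N)) (*-monoʳ-< N (n<1+n (1 + N))) ⟩
  suc (2 * N) * (N * (2 + N))                    ∎
  where
  open ≤-Reasoning
  N = 2 * suc (2 * d) * p

  instance
    N≢0 : NonZero N
    N≢0 = m*n≢0 (2 * suc (2 * d)) p

  0<N : 1 ≤ N
  0<N = >-nonZero⁻¹ N

  0<2Np : 1 ≤ N * p + N * p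
  0<2Np = m≤n⇒m≤n+o (N * p) (≤-trans 0<N (m≤m*n N p))

  collect : ∀ N d p → (N + 2 * N * d) * (N * p + N * p + 2 * N * p) ≡ 2 * (2 * suc (2 * d) * p) * (N * N)
  collect = solve-∀

-- Induction on the number of stages: the last stage decides the race i = n, and the earlier races
-- are inherited.
race : ∀ n i → i < n →
       size (sums (height (suc i)) (racer (parity i ℙ.⁻¹) n)) <
       size (sums (height (suc i)) (racer (parity i) n))
race (suc n) i i<1+n with m≤n⇒m<n∨m≡n (s≤s⁻¹ i<1+n)
-- An old race: its height is below `period n`, so both sides gain the same positive factor and the
-- strict inequality survives.
... | inj₁ i<n = begin-strict
  size (sums h (racer q′ (suc n)))                   ≡⟨ size-racer q′ n h h≤ ⟩
  size (sums h (racer q′ n)) * size (sums h (T q′))  ≡⟨ cong (size (sums h (racer q′ n)) *_) T≡ ⟩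
  size (sums h (racer q′ n)) * size (sums h (T q))   <⟨ *-monoˡ-< _ {{T≢0}} (race n i i<n) ⟩
  size (sums h (racer q n)) * size (sums h (T q))    ≡⟨ size-racer q n h h≤ ⟨
  size (sums h (racer q (suc n)))                    ∎
  where
  open ≤-Reasoning
  h  = height (suc i)
  q  = parity i
  q′ = q ℙ.⁻¹

  T : Parity → List ℕ
  T q = triple (ratio n) (period n) (q ℙ.+ parity n)

  h≤ : h ≤ height (suc n)
  h≤ = height-mono-≤ (m≤n⇒m≤1+n i<n)

  T≡ : size (sums h (T q′)) ≡ size (sums h (T q))
  T≡ = size-triple-≡ (ratio n) (period n) (s≤s (height-mono-≤ i<n))
         (q′ ℙ.+ parity n) (q ℙ.+ parity n)

  T≢0 : NonZero (size (sums h (T q)))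
  T≢0 = >-nonZero (≤-<-trans z≤n (size-sums-> h (span n)
          (0∈triple _ _ (q ℙ.+ parity n)) (max∈triple _ _ (q ℙ.+ parity n))))
-- The new race: q + q is `0ℙ`, so racer q gets C, while its opponent gets D. The upper bound for
-- the opponent and the lower bound for racer q are separated by `crude-bound`.
... | inj₂ refl = begin-strict
  size (sums h (racer q′ (suc n)))                           ≡⟨ size-racer q′ n h ≤-refl ⟩
  size (sums h (racer q′ n)) * size (sums h (T (q′ ℙ.+ q)))  ≡⟨ cong ((size (sums h (racer q′ n)) *_) ∘ T-size) (p⁻¹+p≡1ℙ q) ⟩
  size (sums h (racer q′ n)) * size (sums h (T 1ℙ))          ≤⟨ *-mono-≤ (size-sums-≤ h (racer-bounded q′ n))
                                                                  (size-triple-≤ (ratio n) (period n) h) ⟩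
  suc (h * width n) * suc (h * period n)                     <⟨ crude-bound (width n) (period n) ⟩
  suc h * (span n * (2 + span n))                            ≤⟨ *-mono-≤ racer≥ (size-triple-≥ (ratio n) (period n)) ⟩
  size (sums h (racer q n)) * size (sums h (T 0ℙ))           ≡⟨ cong ((size (sums h (racer q n)) *_) ∘ T-size) (p+p≡0ℙ q) ⟨
  size (sums h (racer q n)) * size (sums h (T (q ℙ.+ q)))    ≡⟨ size-racer q n h ≤-refl ⟨
  size (sums h (racer q (suc n)))                            ∎
  where
  open ≤-Reasoning
  h  = height (suc n)
  q  = parity n
  q′ = q ℙ.⁻¹

  T : Parity → List ℕ
  T = triple (ratio n) (period n)

  T-size : Parity → ℕ
  T-size r = size (sums h (T r))

  racer≥ : suc h ≤ size (sums h (racer q n))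
  racer≥ = size-sums-> h (width n) {{>-nonZero (0<width n)}} (0∈racer q n) (width∈racer q n)

-- Passage to the integers

-- The leading 0 makes the list visibly nonempty. The racers contain 0, so it adds no element to
-- them.
integers : List ℕ → List⁺ ℤ
integers xs = ℤ.+ 0 ∷ map ℤ.+_ xs

∈-integers⁺ : ∀ {xs a} → a ∈ xs → ℤ.+ a ∈ toList (integers xs)
∈-integers⁺ a∈ = there (∈-map⁺ ℤ.+_ a∈)

∈-integers⁻ : ∀ {xs z} → 0 ∈ xs → z ∈ toList (integers xs) → ∃ λ a → a ∈ xs × z ≡ ℤ.+ a
∈-integers⁻ 0∈ (here refl) = 0 , 0∈ , refl
∈-integers⁻ 0∈ (there z∈)  = ∈-map⁻ ℤ.+_ z∈

-- The embedding of the naturals is injective, so it matches the two sets one to one and each count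
-- bounds the other.
∣∣≡size : ∀ {zs xs} → (∀ {z} → z ∈ zs → ∃ λ a → a ∈ xs × z ≡ ℤ.+ a) →
          (∀ {a} → a ∈ xs → ℤ.+ a ∈ zs) → ∣ zs ∣ ≡ size xs
∣∣≡size {zs} zs⊆xs xs⊆zs = ≤-antisym
  (length-≤ (λ z a → z ≡ ℤ.+ a) (deduplicate-! ℤ._≟_ zs)
    (λ z∈ → let a , a∈ , eq = zs⊆xs (∈-deduplicate⁻ ℤ._≟_ zs z∈) in a , ∈-deduplicate⁺ _≟_ a∈ , eq)
    (λ p q → trans p (sym q)))
  (size≤length (λ a z → z ≡ ℤ.+ a)
    (λ a∈ → _ , ∈-deduplicate⁺ ℤ._≟_ (xs⊆zs a∈) , refl)
    (λ p q → ℤ.+-injective (trans (sym p) q)))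

∣integers∣ : ∀ {xs} → 0 ∈ xs → ∣ toList (integers xs) ∣ ≡ size xs
∣integers∣ 0∈ = ∣∣≡size (∈-integers⁻ 0∈) ∈-integers⁺

sumᵛ-integers : ∀ {h xs} {v : Vec ℤ h} → 0 ∈ xs → Allᵛ (_∈ toList (integers xs)) v →
                ∃ λ k → k ∈ sums h xs × sumᵛ v ≡ ℤ.+ k
sumᵛ-integers 0∈ []ᵃ = 0 , here refl , refl
sumᵛ-integers 0∈ (z∈ ∷ᵃ zs∈)
  with a , a∈ , refl ← ∈-integers⁻ 0∈ z∈ | k , k∈ , eq ← sumᵛ-integers 0∈ zs∈
  = a + k , ∈-cartesianProductWith⁺ _+_ a∈ k∈ , cong (ℤ._+_ (ℤ.+ a)) eq

sums-integers : ∀ h {xs k} → k ∈ sums h xs →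
                ∃ λ (v : Vec ℤ h) → Allᵛ (_∈ toList (integers xs)) v × ℤ.+ k ≡ sumᵛ v
sums-integers zero    (here refl) = []ᵛ , []ᵃ , refl
sums-integers (suc h) {xs} k∈
  with a , s , a∈ , s∈ , refl ← ∈-cartesianProductWith⁻ _+_ xs (sums h xs) k∈
  with v , v∈ , eq ← sums-integers h s∈
  = ℤ.+ a ∷ᵛ v , ∈-integers⁺ a∈ ∷ᵃ v∈ , cong (ℤ._+_ (ℤ.+ a)) eq

∣⋆integers∣ : ∀ h {xs} → 0 ∈ xs → ∣ h ⋆ integers xs ∣ ≡ size (sums h xs)
∣⋆integers∣ h {xs} 0∈ = ∣∣≡size
  (λ z∈ → let v , v∈ , z≡ = to z∈
              k , k∈ , v≡ = sumᵛ-integers 0∈ v∈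
          in k , k∈ , trans z≡ v≡)
  (λ k∈ → from (sums-integers h k∈))
  where open module E {x} = Equivalence (∈-⋆ h (integers xs) {x})

-- Maximum, minimum and diameter

foldr₁-∈ : ∀ (_∙_ : ℤ → ℤ → ℤ) → (∀ x y → x ∙ y ≡ x ⊎ x ∙ y ≡ y) →
           ∀ z zs → foldr₁ _∙_ (z ∷ zs) ∈ z ∷ zs
foldr₁-∈ _∙_ sel z []       = here refl
foldr₁-∈ _∙_ sel z (y ∷ ys) with sel z (foldr₁ _∙_ (y ∷ ys))
... | inj₁ eq = here eq
... | inj₂ eq = there (subst (_∈ y ∷ ys) (sym eq) (foldr₁-∈ _∙_ sel y ys))

≤-foldr₁-⊔ : ∀ {x} z zs → x ∈ z ∷ zs → x ℤ.≤ foldr₁ ℤ._⊔_ (z ∷ zs)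
≤-foldr₁-⊔ z []       (here refl) = ℤ.≤-refl
≤-foldr₁-⊔ z (y ∷ ys) (here refl) = ℤ.i≤i⊔j z _
≤-foldr₁-⊔ z (y ∷ ys) (there x∈)  = ℤ.≤-trans (≤-foldr₁-⊔ y ys x∈) (ℤ.i≤j⊔i z _)

foldr₁-⊓-≤ : ∀ {x} z zs → x ∈ z ∷ zs → foldr₁ ℤ._⊓_ (z ∷ zs) ℤ.≤ x
foldr₁-⊓-≤ z []       (here refl) = ℤ.≤-refl
foldr₁-⊓-≤ z (y ∷ ys) (here refl) = ℤ.i⊓j≤i z _
foldr₁-⊓-≤ z (y ∷ ys) (there x∈)  = ℤ.≤-trans (ℤ.i⊓j≤j z _) (foldr₁-⊓-≤ y ys x∈)

diam-integers : ∀ {d xs} → 0 ∈ xs → d ∈ xs → (∀ {a} → a ∈ xs → a ≤ d) → diam (integers xs) ≡ ℤ.+ d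
diam-integers {d} {xs} 0∈ d∈ xs≤d = trans (cong₂ ℤ._-_ max≡ min≡) (ℤ.+-identityʳ (ℤ.+ d))
  where
  max≡ : foldr₁ ℤ._⊔_ (integers xs) ≡ ℤ.+ d
  -- The maximum is selective, so the fold is itself an entry and hence at most d; it is at least d
  -- because d is an entry.
  max≡ with a , a∈ , eq ← ∈-integers⁻ 0∈ (foldr₁-∈ ℤ._⊔_ ℤ.⊔-sel (ℤ.+ 0) (map ℤ.+_ xs))
    = ℤ.≤-antisym (subst (ℤ._≤ ℤ.+ d) (sym eq) (ℤ.+≤+ (xs≤d a∈)))
                  (≤-foldr₁-⊔ (ℤ.+ 0) (map ℤ.+_ xs) (∈-integers⁺ d∈))

  min≡ : foldr₁ ℤ._⊓_ (integers xs) ≡ ℤ.+ 0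
  min≡ with a , a∈ , eq ← ∈-integers⁻ 0∈ (foldr₁-∈ ℤ._⊓_ ℤ.⊓-sel (ℤ.+ 0) (map ℤ.+_ xs))
    = ℤ.≤-antisym (foldr₁-⊓-≤ (ℤ.+ 0) (map ℤ.+_ xs) (here refl))
                  (subst (ℤ.+ 0 ℤ.≤_) (sym eq) (ℤ.+≤+ z≤n))

-- Parity of positions and the final assembly

2∣suc⇒odd : ∀ n → 2 ∣ suc n → parity n ≡ 1ℙ
2∣suc⇒odd zero          2∣1 = contradiction (∣1⇒≡1 2∣1) λ ()
2∣suc⇒odd (suc zero)    _   = refl
2∣suc⇒odd (suc (suc n)) 2∣  = 2∣suc⇒odd n (∣m+n∣m⇒∣n 2∣ ∣-refl)

2∤suc⇒even : ∀ n → ¬ (2 ∣ suc n) → parity n ≡ 0ℙ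
2∤suc⇒even zero          _  = refl
2∤suc⇒even (suc zero)    2∤ = contradiction ∣-refl 2∤
2∤suc⇒even (suc (suc n)) 2∤ = 2∤suc⇒even n (2∤ ∘ ∣m∣n⇒∣m+n ∣-refl)

theorem1 : (m : ℕ) → 3 ≤ m →
    ∃ λ (A : List⁺ ℤ) → ∃ λ (B : List⁺ ℤ) → ∃ λ (h : Fin m → ℕ) →
    (∀ i → 0 < h i) ×
    (∀ i j → i <ᶠ j → h i < h j) ×
    ∣ toList A ∣ ≡ ∣ toList B ∣ ×
    diam A ≡ diam B ×
    (∀ i → ¬ (2 ∣ suc (toℕ i)) → ∣ h i ⋆ A ∣ > ∣ h i ⋆ B ∣) ×
    (∀ i → 2 ∣ suc (toℕ i) → ∣ h i ⋆ A ∣ < ∣ h i ⋆ B ∣)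
theorem1 m _ =
    set 0ℙ , set 1ℙ , h
  -- Positivity is monotonicity from `height zero`, which is 1.
  , (λ i → height-mono-≤ {n = suc (toℕ i)} z≤n)
  , (λ i j i<j → height-mono-< (s≤s i<j))
  , trans (size≡ 0ℙ) (trans (size-racers-≡ m 0ℙ 1ℙ) (sym (size≡ 1ℙ)))
  , trans (diam≡ 0ℙ) (sym (diam≡ 1ℙ))
  -- Positions in `Fin m` start at 0, so the odd-numbered races have even `toℕ i` and are won by the
  -- set of parity `0ℙ`, which is A.
  , (λ i 2∤ → winner i (2∤suc⇒even (toℕ i) 2∤))
  , (λ i 2∣ → winner i (2∣suc⇒odd (toℕ i) 2∣))
  where
  set : Parity → List⁺ ℤ
  set q = integers (racer q m)

  h : Fin m → ℕ
  h i = height (suc (toℕ i))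

  size≡ : ∀ q → ∣ toList (set q) ∣ ≡ size (sums 1 (racer q m))
  size≡ q = trans (∣integers∣ (0∈racer q m)) (sym (size-1-sums (racer q m)))

  diam≡ : ∀ q → diam (set q) ≡ ℤ.+ width m
  diam≡ q = diam-integers (0∈racer q m) (width∈racer q m) (racer-bounded q m)

  winner : ∀ i {q} → parity (toℕ i) ≡ q → ∣ h i ⋆ set (q ℙ.⁻¹) ∣ < ∣ h i ⋆ set q ∣
  winner i refl = subst₂ _<_
    (sym (∣⋆integers∣ (h i) (0∈racer _ m))) (sym (∣⋆integers∣ (h i) (0∈racer _ m)))
    (race m (toℕ i) (toℕ<n i))
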